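{- Let $PO$ be a program order, $M$ a program block map, and let $q$ be a valid final sequence of memory operations for $(PO,M)$. Suppose that for all identifiers $id,id'$ the following TSO axioms hold: Axiom LoadOp for $(id,id',PO,q,M)$, Axiom StoreStore for $(id,id',PO,q,M)$, and Axiom Atomicity for $(id,id',PO,q,M)$ (with $id$ in the role of $id_l$ and $id'$ in the role of $id_s$). Then there exists a valid final memory execution sequence of the operational TSO model for $(PO,M)$ whose last witness has executed sequence equal to $q$.
   Context: **Programs.** Processors and identifiers are natural numbers. A program block map $M$ assigns to each identifier $id$ a block: a list of instructions (containing at most one memory access instruction, which is then last), a processor $proc(id)$, and an optional identifier $atom(id)$ (possibly undefined; for an atomic store block it is the identifier of the atomic load block coming from the same atomic load-store instruction). Each block has a type $type_{id}\in\{ld,st,ald,ast,non\}$ (load, store, atomic load, atomic store, no memory operation). "Store operation" below means type in $\{st,ast\}$. A program order $PO$ assigns to each processor $p$ a finite list $PO(p)$ of identifiers. Write $id_1;_p id_2$ if $id_1$ occurs before $id_2$ in the list $PO(p)$, and $id_1;id_2$ if $id_1;_p id_2$ for some $p$. **Valid program.** $(PO,M)$ is a valid program if: (1) for all $a,b,c$: if $atom(a)$ is defined and equals $b$, and $a\ne c$, then $atom(c)$ is not equal to $b$; (2) if $a\in PO(p)$ has type $ald$, there is $b$ with $a;_p b$, $type_b=ast$, $atom(b)=a$; (3) if $b\in PO(p)$ has type $ast$, there is $a$ with $a;_p b$, $type_a=ald$, $atom(b)=a$; (4) every list $PO(p)$ has no repeated elements; (5) if $a;_p b$ then $proc(a)=proc(b)=p$;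 (6) if $a\in PO(p)$ then $proc(a)=p$. **Valid final sequence of memory operations.** A finite list $q$ of identifiers is a valid final sequence of memory operations for $(PO,M)$ if: $(PO,M)$ is a valid program; $q$ is nonempty; an identifier is in $q$ iff it is in $PO(p)$ for some $p$; $q$ has no repeated elements; and every $id$ belonging to some $PO(p)$ has type in $\{ld,st,ald,ast\}$. **Memory order.** For a finite sequence $x$ of identifiers, $id_1<_x id_2$ is the partial truth value: if both are in $x$, it is true iff $id_1$ is before $id_2$ in $x$ (and false otherwise); if only $id_1$ is in $x$, true; if only $id_2$ is in $x$, false; if neither is in $x$, undefined. Asserting $id_1<_x id_2$ means that this value is (defined and) true. **Axioms.** - LoadOp$(id,id',PO,x,M)$: if $type_{id}\in\{ld,ald\}$ and $id;id'$, then $id<_x id'$. - StoreStore$(id,id',PO,x,M)$: if $id,id'$ are store operations and $id;id'$, then $id<_x id'$. - Atomicity$(id_l,id_s,PO,x,M)$: if $atom(id_s)=id_l$ (they come from the same instruction instance), $id_l;id_s$, $type_{id_l}=ald$ and $type_{id_s}=ast$, then $id_l<_x id_s$, and for every store operation $id\in x$ with $id\ne id_s$, either $id<_x id_l$ or $id_s<_x id$. **States.** There is a nonempty set of machine states (control and general registers, memory, annul flags, recorded address $op_{addr}$ and value $op_{val}$ of each operation, next-block indices, and a global flag). Each state $s$ has a component $flag_{atom}(s)$ which is either an identifier or undefined. The instruction semantics supplies total functions on states (depending on $PO,M$): $exe_{id}$ (processor $proc(id)$ executes its blocks in program order from its next-block index through $id$), $exe^{pre}_{id}$ (the same, but stopping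 before the last instruction of block $id$), $exe^{last}_{id}\,v$ (executes the last instruction of block $id$, a load, with loaded 32-bit word $v$), and $W_{mem}\,id$ (writes $op_{val}$ of $id$ at address $op_{addr}$ of $id$ in memory). None of these changes $flag_{atom}$. These functions may be regarded as given parameters. $flag^{set}_{atom}\,v\,s$ is the state $s$ with $flag_{atom}$ set to $v$ ($v$ an identifier or $undef$). $Lval_{id}$ is the word determined by Axiom Value from the current $x$ and state: $op_{val}$ of the last element, in the order $<$ (memory order before), of the set of store operations $id'$ whose $op_{addr}$ equals the load address of $id$ and which satisfy $id'<_x id$ or $id';id$ (an arbitrary fixed word if this does not determine an element). **Operational model.** A step executing $id$, written $x,s\leadsto_{id}x',s'$, holds iff $x'=x@[id]$ ($@$ is concatenation) and one of the following holds: - (load) $type_{id}=ld$; every $id'$ with $id';id$ and $type_{id'}\in\{ld,ald\}$ is in $x$; $s'=exe^{last}_{id}\,Lval_{id}\,(exe^{pre}_{id}\,s)$. - (store) $type_{id}=st$; $flag_{atom}(s)$ undefined; every $id'$ with $id';id$ and $type_{id'}\in\{ld,ald,st,ast\}$ is in $x$; $s'=W_{mem}\,id\,(exe_{id}\,s)$. - (atom_load) $type_{id}=ald$; $flag_{atom}(s)$ undefined; every $id'$ with $id';id$ and $type_{id'}\in\{ld,ald,st,ast\}$ is in $x$; $s'=flag^{set}_{atom}\,id\,(exe^{last}_{id}\,Lval_{id}\,(exe^{pre}_{id}\,s))$. - (atom_store) $type_{id}=ast$; $flag_{atom}(s)$ and $atom(id)$ are both defined and equal; every $id''$ with $id'';id$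 and $type_{id''}\in\{ld,ald,st,ast\}$ is in $x$; $s'=W_{mem}\,id\,(flag^{set}_{atom}\,undef\,(exe_{id}\,s))$. - (non_mem) $type_{id}=non$; every $id'$ with $id';id$ and $type_{id'}\in\{ld,ald,st,ast\}$ is in $x$; $s'=exe_{id}\,s$. **Execution sequences.** A witness is a triple $(x,R,s)$: executed sequence $x$, set $R$ of remaining identifiers, state $s$. There is a transition $(x,R,s)\to(x',R',s')$ iff there is $id\in R$ with $x,s\leadsto_{id}x',s'$ and $R'=R\setminus\{id\}$. A valid memory execution sequence for $(PO,M)$ is a nonempty finite list of witnesses $w_0,\dots,w_n$ such that: $(PO,M)$ is a valid program; the executed sequence of $w_0$ is empty; the remaining set of $w_0$ is exactly $\{id : id\in PO(p)\text{ for some }p\}$; $flag_{atom}$ of the state of $w_0$ is undefined; and $w_i\to w_{i+1}$ for all $i<n$. It is final if moreover the remaining set of $w_0$ equals the set of elements of the executed sequence of $w_n$. -}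

module Defs where

open import Data.Bool.Base using (Bool; true; false)
open import Data.Fin.Base as Fin using (Fin)
import Data.Fin.Properties as Fin
open import Data.List.Base using (List; []; _∷_; [_]; _++_; length; lookup; last)
open import Data.List.Membership.Propositional using (_∈_)
import Data.List.Membership.DecPropositional as DecMembership
open import Data.List.NonEmpty.Base as List⁺ using (List⁺)
open import Data.List.Relation.Unary.Linked using (Linked)
open import Data.List.Relation.Unary.Unique.Propositional using (Unique)
open import Data.Maybe.Base using (Maybe; just; nothing; maybe′)
open import Data.Nat.Base using (ℕ)
open import Data.Nat.Properties using (_≟_)
open import Data.Product.Base using (_×_; ∃; ∃₂; ∃-syntax)
open import Data.Sum.Base using (_⊎_)
open import Data.Vec.Base using (Vec)
open import Level using (0ℓ)
open import Relation.Binary.PropositionalEquality.Core using (_≡_; _≢_)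
open import Relation.Nullary.Decidable using (Dec; yes; no; does; _×-dec_)
open import Relation.Nullary.Negation using (¬_)
open import Relation.Unary using (Pred; _≐_; _∖_; ｛_｝) renaming (_∈_ to _∈ᴾ_)

open DecMembership _≟_ using (_∈?_)

Proc : Set
Proc = ℕ

Id : Set
Id = ℕ

Word : Set
Word = Vec Bool 32

data OpType : Set where
  ld st ald ast non : OpType

loads stores memOps : List OpType
loads  = ld ∷ ald ∷ []
stores = st ∷ ast ∷ []
memOps = ld ∷ ald ∷ st ∷ ast ∷ []

-- The two halves of an atomic load-store instruction count as separate
-- instructions, of types ald and ast; non marks instructions without memory
-- access.
record InstructionSet : Set₁ where
  field
    Instr : Set
    kind  : Instr → OpType

open InstructionSet

record Block (I : InstructionSet) : Set where
  field
    insts : List (Instr I)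
    proc  : Proc
    atom  : Maybe Id
    -- At most one instruction accesses memory, and it is then the last one.
    memoryAccessIsLast : ∀ is i js → insts ≡ is ++ i ∷ js → kind I i ≢ non → js ≡ []

  type : OpType
  type = maybe′ (kind I) non (last insts)

BlockMap : InstructionSet → Set
BlockMap I = Id → Block I

ProgramOrder : Set
ProgramOrder = Proc → List Id

Before : List Id → Id → Id → Set
Before l a b = ∃₂ λ (i j : Fin (length l)) → i Fin.< j × lookup l i ≡ a × lookup l j ≡ b

before? : ∀ l a b → Dec (Before l a b)
before? l a b = Fin.any? λ i → Fin.any? λ j →
  (i Fin.<? j) ×-dec (lookup l i ≟ a) ×-dec (lookup l j ≟ b)

infix 4 _⊢_⨾[_]_ _⊢_⨾_ _<[_]_

_⊢_⨾[_]_ : ProgramOrder → Id → Proc → Id → Set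
PO ⊢ a ⨾[ p ] b = Before (PO p) a b

_⊢_⨾_ : ProgramOrder → Id → Id → Set
PO ⊢ a ⨾ b = ∃[ p ] PO ⊢ a ⨾[ p ] b

Occurs : ProgramOrder → Pred Id 0ℓ
Occurs PO a = ∃[ p ] a ∈ PO p

-- The memory order is a partial truth value: nothing means undefined.
memOrder : List Id → Id → Id → Maybe Bool
memOrder x a b with a ∈? x | b ∈? x
... | yes _ | yes _ = just (does (before? x a b))
... | yes _ | no  _ = just true
... | no  _ | yes _ = just false
... | no  _ | no  _ = nothing

_<[_]_ : Id → List Id → Id → Set
a <[ x ] b = memOrder x a b ≡ just true

module _ {I : InstructionSet} (M : BlockMap I) where

  typeOf : Id → OpType
  typeOf a = Block.type (M a)

  atomOf : Id → Maybe Id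
  atomOf a = Block.atom (M a)

  procOf : Id → Proc
  procOf a = Block.proc (M a)

module _ {I : InstructionSet} (PO : ProgramOrder) (M : BlockMap I) where

  record ValidProgram : Set where
    field
      atom-injective : ∀ a b c → atomOf M a ≡ just b → a ≢ c → atomOf M c ≢ just b
      ald-paired     : ∀ p a → a ∈ PO p → typeOf M a ≡ ald →
                       ∃[ b ] PO ⊢ a ⨾[ p ] b × typeOf M b ≡ ast × atomOf M b ≡ just a
      ast-paired     : ∀ p b → b ∈ PO p → typeOf M b ≡ ast →
                       ∃[ a ] PO ⊢ a ⨾[ p ] b × typeOf M a ≡ ald × atomOf M b ≡ just a
      unique         : ∀ p → Unique (PO p)
      ⨾-proc         : ∀ p a b → PO ⊢ a ⨾[ p ] b → procOf M a ≡ p × procOf M b ≡ p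
      ∈-proc         : ∀ p a → a ∈ PO p → procOf M a ≡ p

  record ValidFinalSequence (q : List Id) : Set where
    field
      validProgram : ValidProgram
      nonempty     : q ≢ []
      elements     : (_∈ q) ≐ Occurs PO
      unique       : Unique q
      memoryOnly   : ∀ a → Occurs PO a → typeOf M a ∈ memOps

  LoadOp : Id → Id → List Id → Set
  LoadOp a b x = typeOf M a ∈ loads → PO ⊢ a ⨾ b → a <[ x ] b

  StoreStore : Id → Id → List Id → Set
  StoreStore a b x = typeOf M a ∈ stores → typeOf M b ∈ stores → PO ⊢ a ⨾ b → a <[ x ] b

  Atomicity : Id → Id → List Id → Set
  Atomicity l s x =
    atomOf M s ≡ just l → PO ⊢ l ⨾ s → typeOf M l ≡ ald → typeOf M s ≡ ast →
    l <[ x ] s ×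
    (∀ a → a ∈ x → typeOf M a ∈ stores → a ≢ s → a <[ x ] l ⊎ s <[ x ] a)

-- Core collects every state component other than the atomic flag: registers,
-- memory, annul flags, recorded addresses and values, next-block indices.
record State (Core : Set) : Set where
  field
    core     : Core
    flagAtom : Maybe Id

open State public

setFlag : ∀ {Core} → Maybe Id → State Core → State Core
setFlag v s = record s { flagAtom = v }

record Semantics {I : InstructionSet} (PO : ProgramOrder) (M : BlockMap I) : Set₁ where
  field
    Core     : Set
    someCore : Core

    -- nothing: no address or value has been recorded for the operation yet
    opAddr : State Core → Id → Maybe Word
    opVal  : State Core → Id → Maybe Word

    -- address accessed by the load that ends the given block, as computed
    -- in the given state
    loadAddr : Id → State Core → Word

    exe      : Id → State Core → State Core
    exePre   : Id → State Core → State Core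
    exeLast  : Id → Word → State Core → State Core
    writeMem : Id → State Core → State Core

    -- the load result when Axiom Value determines none
    defaultWord : Word

    exe-flag      : ∀ a s → flagAtom (exe a s) ≡ flagAtom s
    exePre-flag   : ∀ a s → flagAtom (exePre a s) ≡ flagAtom s
    exeLast-flag  : ∀ a v s → flagAtom (exeLast a v s) ≡ flagAtom s
    writeMem-flag : ∀ a s → flagAtom (writeMem a s) ≡ flagAtom s

module _ {I : InstructionSet} {PO : ProgramOrder} {M : BlockMap I} (S : Semantics PO M) where

  open Semantics S

  VisibleStore : List Id → State Core → Id → Pred Id 0ℓ
  VisibleStore x s a b =
    typeOf M b ∈ stores ×
    opAddr s b ≡ just (loadAddr a s) ×
    (b <[ x ] a ⊎ PO ⊢ b ⨾ a)

  LastVisibleStore : List Id → State Core → Id → Pred Id 0ℓ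
  LastVisibleStore x s a b =
    VisibleStore x s a b × (∀ c → VisibleStore x s a c → c ≢ b → c <[ x ] b)

  Determined : List Id → State Core → Id → Pred Word 0ℓ
  Determined x s a v = ∃[ b ] LastVisibleStore x s a b × opVal s b ≡ just v

  -- Lval is given by its graph, since b ⨾ a quantifies over all processors.
  Lval : List Id → State Core → Id → Pred Word 0ℓ
  Lval x s a v = Determined x s a v ⊎ (¬ ∃ (Determined x s a)) × v ≡ defaultWord

  AllDone : List OpType → List Id → Id → Set
  AllDone ts x a = ∀ b → PO ⊢ b ⨾ a → typeOf M b ∈ ts → b ∈ x

  -- The load value is taken in the state after exePre, which has recorded the
  -- addresses and values of the program-order-earlier stores.
  data Rule (x : List Id) (s : State Core) (a : Id) (s′ : State Core) : Set where
    load : ∀ v →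
      typeOf M a ≡ ld →
      AllDone loads x a →
      Lval x (exePre a s) a v →
      s′ ≡ exeLast a v (exePre a s) →
      Rule x s a s′
    store :
      typeOf M a ≡ st →
      flagAtom s ≡ nothing →
      AllDone memOps x a →
      s′ ≡ writeMem a (exe a s) →
      Rule x s a s′
    atom-load : ∀ v →
      typeOf M a ≡ ald →
      flagAtom s ≡ nothing →
      AllDone memOps x a →
      Lval x (exePre a s) a v →
      s′ ≡ setFlag (just a) (exeLast a v (exePre a s)) →
      Rule x s a s′
    atom-store : ∀ l →
      typeOf M a ≡ ast →
      flagAtom s ≡ just l →
      atomOf M a ≡ just l →
      AllDone memOps x a →
      s′ ≡ writeMem a (setFlag nothing (exe a s)) →
      Rule x s a s′
    non-mem :
      typeOf M a ≡ non →
      AllDone memOps x a →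
      s′ ≡ exe a s →
      Rule x s a s′

  Step : List Id → State Core → Id → List Id → State Core → Set
  Step x s a x′ s′ = x′ ≡ x ++ [ a ] × Rule x s a s′

  record Witness : Set₁ where
    constructor ⟨_,_,_⟩
    field
      executed  : List Id
      remaining : Pred Id 0ℓ
      state     : State Core

  open Witness public

  infix 4 _⟶_

  _⟶_ : Witness → Witness → Set
  w ⟶ w′ = ∃[ a ] a ∈ᴾ remaining w ×
    Step (executed w) (state w) a (executed w′) (state w′) ×
    remaining w′ ≐ remaining w ∖ ｛ a ｝

  record ValidExecution (ws : List⁺ Witness) : Set₁ where
    field
      validProgram  : ValidProgram PO M
      initExecuted  : executed (List⁺.head ws) ≡ []
      initRemaining : remaining (List⁺.head ws) ≐ Occurs PO
      initFlag      : flagAtom (state (List⁺.head ws)) ≡ nothing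
      linked        : Linked _⟶_ (List⁺.toList ws)

  record ValidFinalExecution (ws : List⁺ Witness) : Set₁ where
    field
      validExecution : ValidExecution ws
      complete       : remaining (List⁺.head ws) ≐ (_∈ executed (List⁺.last ws))

{-# OPTIONS --safe #-}
-- Replaying q from left to right never gets stuck. The axioms LoadOp and
-- StoreStore discharge the program-order side conditions, except for a store
-- before an atomic load: that one is moved through the paired atomic store by
-- Atomicity. The atomic flag always names the unique atomic load whose paired
-- store has not been executed yet, and Atomicity keeps other store operations
-- and other atomic loads out of that window. A load value exists because the
-- visible stores range over a finite list, so Axiom Value is decidable.
module Submission where

open import Defs
open import Data.Bool.Base using (true)
import Data.Bool.Properties as Bool
open import Data.Empty using (⊥-elim)
open import Data.Fin.Base as Fin using (zero; suc)
import Data.Fin.Properties as Fin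
open import Data.List.Base using (List; []; _∷_; [_]; _++_; lookup; initLast; _∷ʳ′_)
open import Data.List.Membership.Propositional using (_∈_; _∉_; find; lose)
open import Data.List.Membership.Propositional.Properties using (∈-++⁺ˡ; ∈-++⁺ʳ; ∈-++⁻; ∈-lookup)
import Data.List.Membership.DecPropositional as DecMembership
open import Data.List.NonEmpty.Base using (last) renaming (_∷_ to _∷⁺_)
open import Data.List.Properties using (++-assoc; ++-identityʳ)
open import Data.List.Relation.Unary.All as All using ([]; _∷_)
open import Data.List.Relation.Unary.AllPairs.Core using ([]; _∷_)
open import Data.List.Relation.Unary.Any as Any using (here; there)
open import Data.List.Relation.Unary.Linked using (Linked; [-]; _∷_)
open import Data.List.Relation.Unary.Unique.Propositional using (Unique)
open import Data.Maybe.Base using (Maybe; just; nothing)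
import Data.Maybe.Properties as Maybe
open import Data.Nat.Base using (s<s⁻¹)
open import Data.Nat.Properties using (_≟_)
open import Data.Product.Base using (_×_; _,_; ∃; ∃-syntax; proj₁; proj₂)
open import Data.Sum.Base using (_⊎_; inj₁; inj₂; [_,_]′)
import Data.Vec.Properties as Vec
open import Function.Base using (_∘_; case_of_)
open import Function.Bundles using (_⇔_; mk⇔; Equivalence)
open import Relation.Binary.PropositionalEquality
  using (_≡_; _≢_; refl; sym; trans; cong; subst)
open import Relation.Nullary.Decidable using (Dec; yes; no; map′; _×-dec_; _⊎-dec_; _→-dec_; ¬?)
open import Relation.Nullary.Negation using (¬_; contradiction)
open import Relation.Unary using (Pred; _∖_) renaming (Decidable to Decidableᴾ)

open DecMembership _≟_ using (_∈?_)

-- Lists without repetition.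

module _ {a} {A : Set a} where

  lookup-injective : ∀ {xs : List A} → Unique xs → ∀ i j → lookup xs i ≡ lookup xs j → i ≡ j
  lookup-injective (_ ∷ _)   zero    zero    _  = refl
  lookup-injective (x∉ ∷ _)  zero    (suc j) eq = contradiction eq (All.lookup x∉ (∈-lookup j))
  lookup-injective (x∉ ∷ _)  (suc i) zero    eq = contradiction (sym eq) (All.lookup x∉ (∈-lookup i))
  lookup-injective (_ ∷ xs!) (suc i) (suc j) eq = cong suc (lookup-injective xs! i j eq)

  unique-++-disjoint : ∀ xs {ys : List A} {z} → Unique (xs ++ ys) → z ∈ xs → z ∉ ys
  unique-++-disjoint (x ∷ xs) (x∉ ∷ _) (here refl) z∈ys = All.lookup x∉ (∈-++⁺ʳ xs z∈ys) refl
  unique-++-disjoint (x ∷ xs) (_ ∷ xs!) (there z∈xs) z∈ys = unique-++-disjoint xs xs! z∈xs z∈ys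

  unique-++-head : ∀ xs {x} {ys : List A} → Unique (xs ++ x ∷ ys) → x ∉ ys
  unique-++-head []       (x∉ ∷ _) x∈ = All.lookup x∉ x∈ refl
  unique-++-head (_ ∷ xs) (_ ∷ u)     = unique-++-head xs u

  -- `last` goes through a view from the right end, which stays stuck until `initLast ys` is split.
  last-∷ : ∀ (x y : A) ys → last (x ∷⁺ y ∷ ys) ≡ last (y ∷⁺ ys)
  last-∷ x y ys with initLast ys
  ... | []       = refl
  ... | _ ∷ʳ′ _  = refl

-- Positions in a list and the memory order.

before-∈ˡ : ∀ {l a b} → Before l a b → a ∈ l
before-∈ˡ (i , _ , _ , refl , _) = ∈-lookup i

before-∈ʳ : ∀ {l a b} → Before l a b → b ∈ l
before-∈ʳ (_ , j , _ , _ , refl) = ∈-lookup j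

before-trans : ∀ {l a b c} → Unique l → Before l a b → Before l b c → Before l a c
before-trans l! (i , j , i<j , eqi , eqj) (j′ , k , j′<k , eqj′ , eqk)
  with refl ← lookup-injective l! j j′ (trans eqj (sym eqj′)) =
  i , k , Fin.<-trans i<j j′<k , eqi , eqk

before-asym : ∀ {l a b} → Unique l → Before l a b → ¬ Before l b a
before-asym l! a<b b<a with i , j , i<j , eqi , eqj ← before-trans l! a<b b<a =
  Fin.<-irrefl (lookup-injective l! i j (trans eqi (sym eqj))) i<j

-- As `b` does not occur in `ys`, its position is at most that of the displayed `x`, so the strictly
-- smaller position of `a` falls within `xs`. The case `b ≡ x` is included.
before-prefix : ∀ xs {x ys a b} → Before (xs ++ x ∷ ys) a b → b ∉ ys → a ∈ xs
before-prefix []       (_     , suc j , _   , _    , refl) b∉ = contradiction (∈-lookup j) b∉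
before-prefix (_ ∷ xs) (zero  , _     , _   , refl , _)    b∉ = here refl
before-prefix (_ ∷ xs) (suc i , suc j , i<j , eqi  , eqj)  b∉ =
  there (before-prefix xs (i , j , s<s⁻¹ i<j , eqi , eqj) b∉)

<[]-∈ : ∀ x a b → a <[ x ] b → a ∈ x
<[]-∈ x a b a<b with a ∈? x | b ∈? x
... | yes a∈x | _     = a∈x
... | no  _   | yes _ = case a<b of λ ()
... | no  _   | no  _ = case a<b of λ ()

-- Membership of `b` rules out the case where `a <[ x ] b` holds merely because `b` is missing from
-- `x`.
<[]⇒before : ∀ x a b → b ∈ x → a <[ x ] b → Before x a b
<[]⇒before x a b b∈x a<b with a ∈? x | b ∈? x
... | no _  | yes _  = case a<b of λ ()
... | _     | no b∉x = contradiction b∈x b∉x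
... | yes _ | yes _ with before? x a b
...   | yes p = p
...   | no  _ = case a<b of λ ()

_<[_]?_ : ∀ a x b → Dec (a <[ x ] b)
a <[ x ]? b = Maybe.≡-dec Bool._≟_ (memOrder x a b) (just true)

store? : ∀ t → Dec (t ∈ stores)
store? st  = yes (here refl)
store? ast = yes (there (here refl))
store? ld  = no λ { (here ()) ; (there (here ())) ; (there (there ())) }
store? ald = no λ { (here ()) ; (there (here ())) ; (there (there ())) }
store? non = no λ { (here ()) ; (there (here ())) ; (there (there ())) }

memOp⇒load⊎store : ∀ {t} → t ∈ memOps → t ∈ loads ⊎ t ∈ stores
memOp⇒load⊎store = ∈-++⁻ loads

is-just? : ∀ {a} {A : Set a} (m : Maybe A) → Dec (∃[ v ] m ≡ just v)
is-just? (just v) = yes (v , refl)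
is-just? nothing  = no λ ()

-- Decidability of Axiom Value.

module LoadValue {I : InstructionSet} {PO : ProgramOrder} {M : BlockMap I}
                 (S : Semantics PO M) (valid : ValidProgram PO M)
                 (x : List Id) (s : State (Semantics.Core S)) (a : Id) where

  open Semantics S
  open ValidProgram valid

  -- The processor hidden in `b ⨾ a` can only be that of `a`, so one list has to be searched instead
  -- of infinitely many.
  ⨾-fix : ∀ {b} → PO ⊢ b ⨾ a → PO ⊢ b ⨾[ procOf M a ] a
  ⨾-fix {b} (p , b⨾a) = subst (λ r → PO ⊢ b ⨾[ r ] a) (sym (proj₂ (⨾-proc p b a b⨾a))) b⨾a

  visible? : Decidableᴾ (VisibleStore S x s a)
  visible? b =
    store? (typeOf M b) ×-dec
    Maybe.≡-dec (Vec.≡-dec Bool._≟_) (opAddr s b) (just (loadAddr a s)) ×-dec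
    ((b <[ x ]? a) ⊎-dec map′ (procOf M a ,_) ⨾-fix (before? (PO (procOf M a)) b a))

  -- A finite bound for the visible stores: `b <[ x ] a` forces `b ∈ x`, and `b ⨾ a` places `b` in
  -- the list of the processor of `a`.
  candidates : List Id
  candidates = x ++ PO (procOf M a)

  visible⇒candidate : ∀ {b} → VisibleStore S x s a b → b ∈ candidates
  visible⇒candidate {b} (_ , _ , inj₁ b<a) = ∈-++⁺ˡ (<[]-∈ x b a b<a)
  visible⇒candidate     (_ , _ , inj₂ b⨾a) = ∈-++⁺ʳ x (before-∈ˡ (⨾-fix b⨾a))

  lastVisible? : Decidableᴾ (LastVisibleStore S x s a)
  lastVisible? b = visible? b ×-dec map′
    (λ all c vis → All.lookup all (visible⇒candidate vis) vis)
    (λ all → All.tabulate λ {c} _ → all c)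
    (All.all? (λ c → visible? c →-dec ¬? (c ≟ b) →-dec (c <[ x ]? b)) candidates)

  -- Lets the search run over stores rather than words: a store records at most one value.
  Determining : Id → Set
  Determining b = LastVisibleStore S x s a b × ∃[ v ] opVal s b ≡ just v

  determined? : Dec (∃ (Determined S x s a))
  determined? = map′
    (λ any → let b , _ , lastVis , v , eq = find {P = Determining} any in v , b , lastVis , eq)
    (λ { (v , b , lastVis , eq) → lose (visible⇒candidate (proj₁ lastVis)) (lastVis , v , eq) })
    (Any.any? (λ b → lastVisible? b ×-dec is-just? (opVal s b)) candidates)

  lval : ∃ (Lval S x s a)
  lval with determined?
  ... | yes (v , det) = v , inj₁ det
  ... | no  ¬det      = defaultWord , inj₂ (¬det , refl)

module Replay {I : InstructionSet} {PO : ProgramOrder} {M : BlockMap I}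
              (S : Semantics PO M) {q : List Id}
              (final      : ValidFinalSequence PO M q)
              (loadOp     : ∀ a b → LoadOp PO M a b q)
              (storeStore : ∀ a b → StoreStore PO M a b q)
              (atomicity  : ∀ l s → Atomicity PO M l s q) where

  open Semantics S
  open ValidFinalSequence final renaming (unique to q!)
  open ValidProgram validProgram

  -- Order in `q` derived from the axioms.

  _⊏_ : Id → Id → Set
  a ⊏ b = Before q a b

  ⊏⇒≢ : ∀ {a b} → a ⊏ b → a ≢ b
  ⊏⇒≢ a⊏a refl = before-asym q! a⊏a a⊏a

  <⇒⊏ : ∀ {a b} → b ∈ q → a <[ q ] b → a ⊏ b
  <⇒⊏ {a} {b} = <[]⇒before q a b

  occurs⇒∈q : ∀ {a} → Occurs PO a → a ∈ q
  occurs⇒∈q = proj₂ elements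

  ⨾-∈ˡ : ∀ {a b} → PO ⊢ a ⨾ b → a ∈ q
  ⨾-∈ˡ (p , a⨾b) = occurs⇒∈q (p , before-∈ˡ a⨾b)

  ⨾-∈ʳ : ∀ {a b} → PO ⊢ a ⨾ b → b ∈ q
  ⨾-∈ʳ (p , a⨾b) = occurs⇒∈q (p , before-∈ʳ a⨾b)

  -- Both hypotheses name the processor of `b`, so they speak of the same repetition-free list.
  ⨾-trans : ∀ {a b c} → PO ⊢ a ⨾ b → PO ⊢ b ⨾ c → PO ⊢ a ⨾ c
  ⨾-trans {a} {b} {c} (p , a⨾b) (r , b⨾c)
    with refl ← trans (sym (proj₂ (⨾-proc p a b a⨾b))) (proj₁ (⨾-proc r b c b⨾c)) =
    p , before-trans (unique p) a⨾b b⨾c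

  load-⊏ : ∀ {a b} → typeOf M a ∈ loads → PO ⊢ a ⨾ b → a ⊏ b
  load-⊏ {a} {b} a-load a⨾b = <⇒⊏ (⨾-∈ʳ a⨾b) (loadOp a b a-load a⨾b)

  store-⊏ : ∀ {a b} → typeOf M a ∈ stores → typeOf M b ∈ stores → PO ⊢ a ⨾ b → a ⊏ b
  store-⊏ {a} {b} a-store b-store a⨾b = <⇒⊏ (⨾-∈ʳ a⨾b) (storeStore a b a-store b-store a⨾b)

  memOp-⊏-store : ∀ {a b} → typeOf M b ∈ stores → typeOf M a ∈ memOps → PO ⊢ a ⨾ b → a ⊏ b
  memOp-⊏-store b-store a-mem a⨾b =
    [ (λ a-load → load-⊏ a-load a⨾b) , (λ a-store → store-⊏ a-store b-store a⨾b) ]′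
      (memOp⇒load⊎store a-mem)

  -- The premises of `Atomicity`, bundled; validity of the program supplies them from either half of
  -- the pair.
  record Paired (l s : Id) : Set where
    field
      atom≡ : atomOf M s ≡ just l
      l⨾s   : PO ⊢ l ⨾ s
      l-ald : typeOf M l ≡ ald
      s-ast : typeOf M s ≡ ast

    s-store : typeOf M s ∈ stores
    s-store = there (here s-ast)

    l⊏s : l ⊏ s
    l⊏s = load-⊏ (there (here l-ald)) l⨾s

    store-outside : ∀ {a} → a ∈ q → typeOf M a ∈ stores → a ≢ s → a ⊏ l ⊎ s ⊏ a
    store-outside {a} a∈q a-store a≢s =
      [ inj₁ ∘ <⇒⊏ (⨾-∈ˡ l⨾s) , inj₂ ∘ <⇒⊏ a∈q ]′
        (proj₂ (atomicity l s atom≡ l⨾s l-ald s-ast) a a∈q a-store a≢s)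

  open Paired

  paired-store : ∀ {l} → l ∈ q → typeOf M l ≡ ald → ∃[ s ] Paired l s
  paired-store {l} l∈q l-ald =
    let p , l∈p = proj₁ elements l∈q
        s , l⨾s , s-ast , eq = ald-paired p l l∈p l-ald
    in s , record { atom≡ = eq ; l⨾s = p , l⨾s ; l-ald = l-ald ; s-ast = s-ast }

  paired-load : ∀ {s} → s ∈ q → typeOf M s ≡ ast → ∃[ l ] Paired l s
  paired-load {s} s∈q s-ast =
    let p , s∈p = proj₁ elements s∈q
        l , l⨾s , l-ald , eq = ast-paired p s s∈p s-ast
    in l , record { atom≡ = eq ; l⨾s = p , l⨾s ; l-ald = l-ald ; s-ast = s-ast }

  -- StoreStore says nothing about a store preceding an atomic load; it does
  -- order that store before the paired atomic store, and Atomicity then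
  -- excludes the interval between the two halves.
  store-⊏-ald : ∀ {a l} → typeOf M a ∈ stores → typeOf M l ≡ ald → PO ⊢ a ⨾ l → a ⊏ l
  store-⊏-ald {a} {l} a-store l-ald a⨾l = case store-outside P (⨾-∈ˡ a⨾l) a-store (⊏⇒≢ a⊏s) of λ where
      (inj₁ a⊏l) → a⊏l
      (inj₂ s⊏a) → contradiction s⊏a (before-asym q! a⊏s)
    where
    s = proj₁ (paired-store (⨾-∈ʳ a⨾l) l-ald)
    P = proj₂ (paired-store (⨾-∈ʳ a⨾l) l-ald)
    a⊏s : a ⊏ s
    a⊏s = store-⊏ a-store (s-store P) (⨾-trans a⨾l (l⨾s P))

  memOp-⊏-ald : ∀ {a l} → typeOf M l ≡ ald → typeOf M a ∈ memOps → PO ⊢ a ⨾ l → a ⊏ l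
  memOp-⊏-ald l-ald a-mem a⨾l =
    [ (λ a-load → load-⊏ a-load a⨾l) , (λ a-store → store-⊏-ald a-store l-ald a⨾l) ]′
      (memOp⇒load⊎store a-mem)

  -- The invariant on the atomic flag.

  Open : List Id → Pred Id _
  Open x l = l ∈ x × ∃[ s ] Paired l s × s ∉ x

  -- Since `f` holds at most one identifier, the equivalence also says that at most one atomic load
  -- is open, and none when `f` is `nothing`.
  FlagTracks : List Id → Maybe Id → Set
  FlagTracks x f = ∀ l → f ≡ just l ⇔ Open x l

  -- One replay step, with `x` executed and `a` next.

  module Next (x : List Id) (a : Id) (ys : List Id) (q≡ : q ≡ x ++ a ∷ ys) where

    split! : Unique (x ++ a ∷ ys)
    split! = subst Unique q≡ q!

    a∈q : a ∈ q
    a∈q = subst (a ∈_) (sym q≡) (∈-++⁺ʳ x (here refl))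

    a∉x : a ∉ x
    a∉x a∈x = unique-++-disjoint x split! a∈x (here refl)

    ⊏a⇒∈x : ∀ {b} → b ⊏ a → b ∈ x
    ⊏a⇒∈x {b} b⊏a =
      before-prefix x (subst (λ r → Before r b a) q≡ b⊏a) (unique-++-head x split!)

    ⊏-∈x⇒∈x : ∀ {b c} → c ∈ x → b ⊏ c → b ∈ x
    ⊏-∈x⇒∈x {b} {c} c∈x b⊏c =
      before-prefix x (subst (λ r → Before r b c) q≡ b⊏c) (unique-++-disjoint x split! c∈x ∘ there)

    -- Otherwise Atomicity puts `a` before `l`, which is already executed, or after `s`, which is
    -- not.
    open-excludes-store : ∀ {l s} → l ∈ x → Paired l s → s ∉ x → typeOf M a ∈ stores → a ≡ s
    open-excludes-store {l} {s} l∈x P s∉x a-store with a ≟ s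
    ... | yes a≡s = a≡s
    ... | no  a≢s = case store-outside P a∈q a-store a≢s of λ where
      (inj₁ a⊏l) → contradiction (⊏-∈x⇒∈x l∈x a⊏l) a∉x
      (inj₂ s⊏a) → contradiction (⊏a⇒∈x s⊏a) s∉x

    -- Atomicity, applied to both pairs, makes their intervals in q disjoint,
    -- but a would start the second one inside the first.
    open-excludes-ald : typeOf M a ≡ ald → ∀ l → ¬ Open x l
    open-excludes-ald a-ald l (l∈x , s , P , s∉x) =
      case store-outside P (⨾-∈ʳ (l⨾s Q)) (s-store Q) (s≢t ∘ sym) of λ where
        (inj₁ t⊏l) → a∉x (⊏-∈x⇒∈x (⊏-∈x⇒∈x l∈x t⊏l) (l⊏s Q))
        (inj₂ s⊏t) → case store-outside Q (⨾-∈ʳ (l⨾s P)) (s-store P) s≢t of λ where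
          (inj₁ s⊏a) → s∉x (⊏a⇒∈x s⊏a)
          (inj₂ t⊏s) → before-asym q! s⊏t t⊏s
      where
      t = proj₁ (paired-store a∈q a-ald)
      Q = proj₂ (paired-store a∈q a-ald)
      s≢t : s ≢ t
      s≢t s≡t = a∉x (subst (_∈ x) l≡a l∈x)
        where l≡a = Maybe.just-injective (trans (sym (atom≡ P)) (trans (cong (atomOf M) s≡t) (atom≡ Q)))

    flag-nothing : ∀ {f} → FlagTracks x f → (∀ l → ¬ Open x l) → f ≡ nothing
    flag-nothing {nothing} _      _     = refl
    flag-nothing {just l}  tracks ¬open = contradiction (Equivalence.to (tracks l) refl) (¬open l)

    -- Preservation of the flag invariant.

    x′ : List Id
    x′ = x ++ [ a ]

    ∉x′ : ∀ {b} → b ∉ x → b ≢ a → b ∉ x′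
    ∉x′ b∉x b≢a b∈ = case ∈-++⁻ x b∈ of λ where
      (inj₁ b∈x)        → b∉x b∈x
      (inj₂ (here b≡a)) → b≢a b≡a

    open-x′ : typeOf M a ≢ ald → ∀ {l} → Open x′ l → Open x l
    open-x′ a-≢ald (l∈x′ , s , P , s∉x′) = case ∈-++⁻ x l∈x′ of λ where
      (inj₁ l∈x)         → l∈x , s , P , s∉x′ ∘ ∈-++⁺ˡ
      (inj₂ (here refl)) → contradiction (l-ald P) a-≢ald

    -- Opening a window takes an operation of type `ald`, closing one takes type `ast`.
    tracks-non-atomic : ∀ {f} → typeOf M a ≢ ald → typeOf M a ≢ ast → FlagTracks x f → FlagTracks x′ f
    tracks-non-atomic {f} a-≢ald a-≢ast tracks l = mk⇔ to′ (from ∘ open-x′ a-≢ald)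
      where
      open Equivalence (tracks l)
      to′ : f ≡ just l → Open x′ l
      to′ eq = let l∈x , s , P , s∉x = to eq in
        ∈-++⁺ˡ l∈x , s , P , ∉x′ s∉x λ { refl → a-≢ast (s-ast P) }

    -- The store paired with `a` follows it in `q`, so it is still pending. Any other open load
    -- would have been open before the step, against `open-excludes-ald`.
    tracks-ald : typeOf M a ≡ ald → FlagTracks x′ (just a)
    tracks-ald a-ald l = mk⇔ to′ from′
      where
      to′ : just a ≡ just l → Open x′ l
      to′ refl =
        let s , P = paired-store a∈q a-ald in
        ∈-++⁺ʳ x (here refl) , s , P ,
        ∉x′ (λ s∈x → a∉x (⊏-∈x⇒∈x s∈x (l⊏s P))) (⊏⇒≢ (l⊏s P) ∘ sym)
      from′ : Open x′ l → just a ≡ just l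
      from′ (l∈x′ , s , P , s∉x′) = case ∈-++⁻ x l∈x′ of λ where
        (inj₁ l∈x)        → ⊥-elim (open-excludes-ald a-ald l (l∈x , s , P , s∉x′ ∘ ∈-++⁺ˡ))
        (inj₂ (here l≡a)) → cong just (sym l≡a)

    -- A window surviving the step was open before it, so its pending store is `a`, which has just
    -- been executed.
    tracks-ast : typeOf M a ≡ ast → FlagTracks x′ nothing
    tracks-ast a-ast l = mk⇔ (λ ()) λ op@(_ , s , P , s∉x′) →
      let l∈x , _ = open-x′ (λ a-ald → case trans (sym a-ast) a-ald of λ ()) op in
      contradiction
        (∈-++⁺ʳ x (here (sym (open-excludes-store l∈x P (s∉x′ ∘ ∈-++⁺ˡ) (there (here a-ast))))))
        s∉x′

    -- Applicability of the rule for each operation type.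

    allDone-⊏ : ∀ {ts} → (∀ {b} → typeOf M b ∈ ts → PO ⊢ b ⨾ a → b ⊏ a) → AllDone S ts x a
    allDone-⊏ earlier b b⨾a b-ts = ⊏a⇒∈x (earlier b-ts b⨾a)

    load-value : ∀ s → ∃ (Lval S x (exePre a s) a)
    load-value s = LoadValue.lval S validProgram x (exePre a s) a

    NextState : State Core → Set
    NextState s = ∃[ s′ ] Rule S x s a s′ × FlagTracks x′ (flagAtom s′)

    step-ld : ∀ s → FlagTracks x (flagAtom s) → typeOf M a ≡ ld → NextState s
    step-ld s tracks a-ld =
      let v , lv = load-value s in
      exeLast a v (exePre a s) ,
      load v a-ld (allDone-⊏ load-⊏) lv refl ,
      subst (FlagTracks x′) (sym (trans (exeLast-flag a v (exePre a s)) (exePre-flag a s)))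
        (tracks-non-atomic (λ eq → case trans (sym a-ld) eq of λ ())
                           (λ eq → case trans (sym a-ld) eq of λ ()) tracks)

    step-st : ∀ s → FlagTracks x (flagAtom s) → typeOf M a ≡ st → NextState s
    step-st s tracks a-st =
      writeMem a (exe a s) ,
      store a-st (flag-nothing tracks ¬open) (allDone-⊏ (memOp-⊏-store (here a-st))) refl ,
      subst (FlagTracks x′) (sym (trans (writeMem-flag a (exe a s)) (exe-flag a s)))
        (tracks-non-atomic (λ eq → case trans (sym a-st) eq of λ ()) a-≢ast tracks)
      where
      a-≢ast : typeOf M a ≢ ast
      a-≢ast eq = case trans (sym a-st) eq of λ ()
      -- An open window would make `a` its pending store and hence of type `ast`.
      ¬open : ∀ l → ¬ Open x l
      ¬open l (l∈x , s , P , s∉x) =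
        a-≢ast (trans (cong (typeOf M) (open-excludes-store l∈x P s∉x (here a-st))) (s-ast P))

    step-ald : ∀ s → FlagTracks x (flagAtom s) → typeOf M a ≡ ald → NextState s
    step-ald s tracks a-ald =
      let v , lv = load-value s in
      setFlag (just a) (exeLast a v (exePre a s)) ,
      atom-load v a-ald (flag-nothing tracks (open-excludes-ald a-ald))
        (allDone-⊏ (memOp-⊏-ald a-ald)) lv refl ,
      tracks-ald a-ald

    step-ast : ∀ s → FlagTracks x (flagAtom s) → typeOf M a ≡ ast → NextState s
    step-ast s tracks a-ast =
      let l , P = paired-load a∈q a-ast in
      writeMem a (setFlag nothing (exe a s)) ,
      -- The window of `l` is open because its store is `a` itself, not yet executed; the invariant
      -- then yields the flag value.
      atom-store l a-ast (Equivalence.from (tracks l) (⊏a⇒∈x (l⊏s P) , a , P , a∉x)) (atom≡ P)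
        (allDone-⊏ (memOp-⊏-store (s-store P))) refl ,
      subst (FlagTracks x′) (sym (writeMem-flag a (setFlag nothing (exe a s)))) (tracks-ast a-ast)

    step : ∀ s → FlagTracks x (flagAtom s) → NextState s
    -- `memoryOnly` excludes type `non`, leaving four rules.
    step s tracks with memoryOnly a (proj₁ elements a∈q)
    ... | here a-ld                         = step-ld s tracks a-ld
    ... | there (here a-ald)                = step-ald s tracks a-ald
    ... | there (there (here a-st))         = step-st s tracks a-st
    ... | there (there (there (here a-ast))) = step-ast s tracks a-ast

  -- Assembling the execution.

  after : List Id → State Core → Witness S
  after x s = ⟨ x , Occurs PO ∖ (_∈ x) , s ⟩

  -- `after` recomputes the remaining set from the prefix instead of deleting identifiers one by
  -- one; the two agree because membership in `x ++ [ a ]` means membership in `x` or equality with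
  -- `a`.
  after-⟶ : ∀ x a ys → q ≡ x ++ a ∷ ys → ∀ {s s′} → Rule S x s a s′ →
            _⟶_ S (after x s) (after (x ++ [ a ]) s′)
  after-⟶ x a ys q≡ rule =
    a , (proj₁ elements a∈q , a∉x) , (refl , rule) ,
    (λ { (occ , ∉x′) → (occ , ∉x′ ∘ ∈-++⁺ˡ) , λ { refl → ∉x′ (∈-++⁺ʳ x (here refl)) } }) ,
    (λ { ((occ , ∉x) , a≢) → occ , ∉x′ ∉x (a≢ ∘ sym) })
    where open Next x a ys q≡

  replay : ∀ x ys → q ≡ x ++ ys → ∀ s → FlagTracks x (flagAtom s) →
           ∃[ ws ] Linked (_⟶_ S) (after x s ∷ ws) × executed (last (after x s ∷⁺ ws)) ≡ q
  replay x []       q≡ s _      = [] , [-] , sym (trans q≡ (++-identityʳ x))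
  replay x (a ∷ ys) q≡ s tracks =
    let s′ , rule , tracks′ = Next.step x a ys q≡ s tracks
        ws , linked , executed≡ =
          replay (x ++ [ a ]) ys (trans q≡ (sym (++-assoc x [ a ] ys))) s′ tracks′
    in after (x ++ [ a ]) s′ ∷ ws ,
       after-⟶ x a ys q≡ rule ∷ linked ,
       trans (cong executed (last-∷ (after x s) (after (x ++ [ a ]) s′) ws)) executed≡

  initial : State Core
  initial = record { core = someCore ; flagAtom = nothing }

  execution : ∃[ ws ] ValidFinalExecution S ws × executed (last ws) ≡ q
  execution =
    -- With nothing executed no load is open, which matches the unset flag.
    let ws , linked , executed≡ = replay [] q refl initial (λ _ → mk⇔ (λ ()) λ { (() , _) })
    in after [] initial ∷⁺ ws ,
       record
         { validExecution = record
           { validProgram  = validProgram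
           ; initExecuted  = refl
           ; initRemaining = proj₁ , (λ occ → occ , λ ())
           ; initFlag      = refl
           ; linked        = linked
           }
         ; complete =
             (λ {b} rem → subst (b ∈_) (sym executed≡) (occurs⇒∈q (proj₁ rem))) ,
             (λ {b} b∈ → proj₁ elements (subst (b ∈_) executed≡ b∈) , λ ())
         } ,
       executed≡

theorem2 :
    (I : InstructionSet) (PO : ProgramOrder) (M : BlockMap I) (S : Semantics PO M) (q : List Id) →
    ValidFinalSequence PO M q →
    (∀ id id′ → LoadOp PO M id id′ q) →
    (∀ id id′ → StoreStore PO M id id′ q) →
    (∀ id id′ → Atomicity PO M id id′ q) →
    ∃[ ws ] ValidFinalExecution S ws × executed (last ws) ≡ q
theorem2 I PO M S q final loadOp storeStore atomicity =
  Replay.execution S final loadOp storeStore atomicity
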